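{- Let $k \ge 1$ be an integer. If $G$ is a $k$-SI graph, then $G$ is bipartite.
   Context: Graphs are finite and simple. For a positive integer $k$, a graph $G$ is a $k$-stepwise irregular graph ($k$-SI graph) if $|d_G(u) - d_G(v)| = k$ for every edge $uv \in E(G)$, where $d_G(x)$ is the degree of $x$ in $G$. -}

module Defs where

open import Data.Nat using (ℕ; ∣_-_∣)
open import Data.Fin using (Fin)
open import Data.Fin.Subset using (Subset; _∈_; ∁; ∣_∣)
open import Data.Product using (∃-syntax; _×_)
open import Data.Vec using (tabulate)
open import Level using (0ℓ)
open import Relation.Binary using (Rel; Symmetric; Decidable)
open import Relation.Binary.PropositionalEquality using (_≡_)
open import Relation.Nullary using (¬_; does)

-- A finite simple graph on the vertex set Fin n.  Adjacency is required to be
-- decidable so that degrees can be computed.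
record Graph (n : ℕ) : Set₁ where
  field
    Adj    : Rel (Fin n) 0ℓ
    adj?   : Decidable Adj
    symm   : Symmetric Adj
    irrefl : ∀ {v} → ¬ Adj v v

  neighbours : Fin n → Subset n
  neighbours v = tabulate (λ u → does (adj? v u))

  degree : Fin n → ℕ
  degree v = ∣ neighbours v ∣

  Independent : Subset n → Set
  Independent X = ∀ {u v} → u ∈ X → v ∈ X → ¬ Adj u v

open Graph public using (degree; Independent)

StepwiseIrregular : ∀ {n} → ℕ → Graph n → Set
StepwiseIrregular k G = ∀ {u v} → Graph.Adj G u v → ∣ degree G u - degree G v ∣ ≡ k

-- The vertex set is partitioned into two (possibly empty) independent sets.
Bipartite : ∀ {n} → Graph n → Set
Bipartite G = ∃[ X ] Independent G X × Independent G (∁ X)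

{-# OPTIONS --safe #-}

-- If |a - b| = k, then ⌊a/k⌋ and ⌊b/k⌋ differ by exactly one, so the parity of
-- ⌊d(v)/k⌋ is a proper 2-colouring.
module Submission where

open import Defs
open import Data.Nat using (ℕ; _≤_; suc; _+_; _/_; ∣_-_∣; NonZero; >-nonZero)
open import Data.Nat.Properties using (≤-total; ∣-∣-comm; m≤n⇒∣m-n∣≡n∸m; m∸n+n≡m)
open import Data.Nat.Divisibility using (∣-refl)
open import Data.Nat.DivMod using (+-distrib-/-∣ˡ; n/n≡1)
open import Data.Nat.GeneralisedArithmetic using (fold)
open import Data.Bool using (Bool; true; not)
open import Data.Bool.Properties using (not-¬; not-involutive; not-injective)
open import Data.Fin using (Fin)
open import Data.Fin.Subset using (_∈_; ∁)
open import Data.Product using (_,_)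
open import Data.Sum using (_⊎_; inj₁; inj₂)
open import Data.Vec using (tabulate)
open import Data.Vec.Properties using ([]=⇒lookup; lookup∘tabulate; lookup-map)
open import Relation.Binary.PropositionalEquality using (_≡_; refl; sym; trans; cong)

-- Colour `v` by the parity of `degree G v / k`. Across an edge the larger degree is the smaller one
-- plus `k`, so the quotient goes up by exactly one and the colour flips (`isEven-/-flip`). This
-- proper 2-colouring yields the bipartition (`properColouring⇒bipartite`).

isEven : ℕ → Bool
isEven = fold true not

[n+m]/n≡1+m/n : ∀ m n .{{_ : NonZero n}} → (n + m) / n ≡ suc (m / n)
[n+m]/n≡1+m/n m n = trans (+-distrib-/-∣ˡ m ∣-refl) (cong (_+ m / n) (n/n≡1 n))

∣m-n∣≡k⇒k+ : ∀ m n {k} → ∣ m - n ∣ ≡ k → m ≡ k + n ⊎ n ≡ k + m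
∣m-n∣≡k⇒k+ m n refl with ≤-total m n
... | inj₁ m≤n rewrite m≤n⇒∣m-n∣≡n∸m m≤n = inj₂ (sym (m∸n+n≡m m≤n))
... | inj₂ n≤m rewrite ∣-∣-comm m n | m≤n⇒∣m-n∣≡n∸m n≤m = inj₁ (sym (m∸n+n≡m n≤m))

isEven-/-flip : ∀ k .{{_ : NonZero k}} m n → ∣ m - n ∣ ≡ k →
                isEven (m / k) ≡ not (isEven (n / k))
isEven-/-flip k m n eq with ∣m-n∣≡k⇒k+ m n eq
-- `isEven (suc q)` reduces to `not (isEven q)`, so no separate parity lemma is needed here; the
-- opposite case meets a double negation instead.
... | inj₁ refl = cong isEven ([n+m]/n≡1+m/n n k)
... | inj₂ refl = sym (trans (cong (λ q → not (isEven q)) ([n+m]/n≡1+m/n m k))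
                             (not-involutive _))

properColouring⇒bipartite : ∀ {n} (G : Graph n) (c : Fin n → Bool) →
  (∀ {u v} → Graph.Adj G u v → c u ≡ not (c v)) → Bipartite G
properColouring⇒bipartite G c proper =
  -- The part is the colour class of `true`. Two members of either class share a colour, whereas
  -- adjacency makes their colours opposite.
  tabulate c ,
  (λ u∈X v∈X uv → not-¬ (trans (colour u∈X) (sym (colour v∈X))) (proper uv)) ,
  (λ u∈∁X v∈∁X uv → not-¬ (not-injective (trans (cocolour u∈∁X) (sym (cocolour v∈∁X)))) (proper uv))
  where
  colour : ∀ {v} → v ∈ tabulate c → c v ≡ true
  colour {v} v∈X = trans (sym (lookup∘tabulate c v)) ([]=⇒lookup v∈X)

  cocolour : ∀ {v} → v ∈ ∁ (tabulate c) → not (c v) ≡ true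
  -- `∁` is `map not` on the membership vector, so being in the complement says that the negated
  -- colour is `true`.
  cocolour {v} v∈∁X = trans (cong not (sym (lookup∘tabulate c v)))
                            (trans (sym (lookup-map v not (tabulate c))) ([]=⇒lookup v∈∁X))

proposition2p1 : ∀ (k : ℕ) → 1 ≤ k → ∀ {n : ℕ} (G : Graph n) → StepwiseIrregular k G → Bipartite G
proposition2p1 k 1≤k G si =
  properColouring⇒bipartite G (λ v → isEven (degree G v / k))
    (λ {u} {v} uv → isEven-/-flip k (degree G u) (degree G v) (si uv))
  where
  instance
    -- Positivity of `k` is what makes division by `k` in the colouring meaningful.
    k≢0 : NonZero k
    k≢0 = >-nonZero 1≤k
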